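{- Let $\mathcal{P}$ be an arbitrary set of prime numbers (finite or infinite), and let $\langle \mathcal{P} \rangle \subset \mathbb{N} = \{1,2,3,\ldots\}$ denote the set of natural numbers all of whose prime factors lie in $\mathcal{P}$ (in particular $1 \in \langle \mathcal{P}\rangle$). Then for every real number $x$, $$\Big|\sum_{n \in \langle \mathcal{P} \rangle:\, n \leq x} \frac{\mu(n)}{n}\Big| \leq 1.$$
   Context: $\mu$ denotes the Möbius function: $\mu(n) = (-1)^k$ if $n$ is a product of $k$ distinct primes, and $\mu(n)=0$ otherwise. $\langle \mathcal{P}\rangle$ is the multiplicative semigroup generated by $\mathcal{P}$ (including $1$ as the empty product). -}

module Defs where

open import Data.Integer.Base as ℤ using (ℤ; +_; -[1+_]; 0ℤ; -1ℤ)
import Data.Integer.Properties as ℤ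
open import Data.List.Base using (List; []; _∷_; length; foldr; map)
open import Data.List.Membership.Propositional using (_∈_)
open import Data.List.Relation.Unary.All as All using ()
open import Data.List.Relation.Unary.AllPairs as AllPairs using ()
open import Data.List.Relation.Unary.Any using (here; there)
open import Data.List.Relation.Unary.Unique.Propositional using (Unique)
open import Data.Nat.Base as ℕ using (ℕ; zero; suc; NonZero)
open import Data.Nat.Divisibility using (_∣_)
import Data.Nat.Properties as ℕ
open import Data.List.Relation.Unary.Unique.DecPropositional ℕ._≟_ using (unique?)
open import Data.Nat.Primality using (Prime)
open import Data.Nat.Primality.Factorisation using (factors; factorise)
open import Data.Product.Base using (∃; _×_; _,_; proj₁; proj₂)
open import Data.Rational.Base as ℚ using (ℚ; 0ℚ; _/_; ↥_)
import Data.Rational.Properties as ℚ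
open import Data.Rational.Unnormalised.Base as ℚᵘ using (mkℚᵘ; *<*)
import Data.Rational.Unnormalised.Properties as ℚᵘ
open import Data.Sum.Base using (_⊎_; inj₁; inj₂)
open import Function.Base using (_∘_)
open import Function.Bundles using (_⇔_; mk⇔; Equivalence)
open import Level using (Level; 0ℓ) renaming (suc to lsuc)
open import Relation.Binary.PropositionalEquality using (_≡_; _≢_; refl; sym; subst)
open import Relation.Nullary using (¬_; yes; no)
open import Relation.Unary using (Pred)

private
  variable
    ℓ : Level

-- Real numbers x as two-sided Dedekind cuts of ℚ: lower q means q < x,
-- and upper q means x < q.
record ℝ : Set (lsuc 0ℓ) where
  field
    lower upper     : Pred ℚ 0ℓ
    lower-inhabited : ∃ lower
    upper-inhabited : ∃ upper
    lower-rounded   : ∀ q → lower q ⇔ (∃ λ r → q ℚ.< r × lower r)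
    upper-rounded   : ∀ q → upper q ⇔ (∃ λ r → r ℚ.< q × upper r)
    disjoint        : ∀ q → ¬ (lower q × upper q)
    located         : ∀ q r → q ℚ.< r → lower q ⊎ upper r

infix 4 _≤ℝ_

_≤ℝ_ : ℕ → ℝ → Set
n ≤ℝ x = ¬ ℝ.upper x (+ n / 1)

-- The value at 0 is a dummy.
μ : ℕ → ℤ
μ zero = 0ℤ
μ n@(suc _) with unique? (factors (factorise n))
... | yes _ = -1ℤ ℤ.^ length (factors (factorise n))
... | no  _ = 0ℤ

-- The value at 0 is a dummy.
μ[n]/n : ℕ → ℚ
μ[n]/n zero      = 0ℚ
μ[n]/n n@(suc _) = μ n / n

⟨_⟩ : Pred ℕ ℓ → Pred ℕ ℓ
⟨ P ⟩ n = NonZero n × (∀ p → Prime p → p ∣ n → P p)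

∑ : List ℕ → (ℕ → ℚ) → ℚ
∑ ns f = foldr ℚ._+_ 0ℚ (map f ns)

-- ns lists every element of A exactly once, so that ∑ ns f is the sum
-- of f over the set A.
record _Enumerates_ (ns : List ℕ) (A : Pred ℕ ℓ) : Set ℓ where
  field
    unique   : Unique ns
    complete : ∀ n → n ∈ ns ⇔ A n

-- The index set of the sum over n ∈ ⟨P⟩ with n ≤ x.
⟨_⟩≤_ : Pred ℕ ℓ → ℝ → Pred ℕ ℓ
(⟨ P ⟩≤ x) n = ⟨ P ⟩ n × n ≤ℝ x

private
  <-bound : ∀ q n → ℤ.∣ ↥ q ∣ ℕ.< n → q ℚ.< + n / 1
  <-bound q@(ℚ.mkℚ a d-1 _) n a<n = ℚ.toℚᵘ-cancel-<
    (ℚᵘ.<-respʳ-≃ (ℚᵘ.≃-sym (ℚ.toℚᵘ-fromℚᵘ (mkℚᵘ (+ n) 0)))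
      (*<* (subst (ℤ._< + n ℤ.* + suc d-1) (sym (ℤ.*-identityʳ a))
        (ℤ.<-≤-trans (a<+n a a<n) n≤n*d))))
    where
    a<+n : ∀ i → ℤ.∣ i ∣ ℕ.< n → i ℤ.< + n
    a<+n (+ _)    i<n = ℤ.+<+ i<n
    a<+n -[1+ _ ] _   = ℤ.-<+
    n≤n*d : + n ℤ.≤ + n ℤ.* + suc d-1
    n≤n*d = subst (+ n ℤ.≤_) (ℤ.pos-* n (suc d-1)) (ℤ.+≤+ (ℕ.m≤m*n n (suc d-1)))

  bounded-enumerable : (A : Pred ℕ ℓ) (N : ℕ) →
                       ¬ ¬ ∃ λ ns → ns Enumerates (λ n → n ℕ.< N × A n)
  bounded-enumerable A zero k = k ([] , record
    { unique   = AllPairs.[]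
    ; complete = λ n → mk⇔ (λ ()) (λ ())
    })
  bounded-enumerable A (suc N) k = bounded-enumerable A N λ (ns , e) →
    k (ns , without-N e λ aN → k (N ∷ ns , with-N e aN))
    where
    A<_ : ℕ → Pred ℕ _
    (A< M) n = n ℕ.< M × A n

    module _ {ns} (e : ns Enumerates (A< N)) where
      open _Enumerates_ e

      out : ∀ {n} → n ∈ ns → (A< suc N) n
      out n∈ns with Equivalence.to (complete _) n∈ns
      ... | n<N , a = ℕ.m<n⇒m<1+n n<N , a

      back : ∀ {n} → n ≢ N → (A< suc N) n → n ∈ ns
      back n≢N (n<1+N , a) =
        Equivalence.from (complete _) (ℕ.≤∧≢⇒< (ℕ.s≤s⁻¹ n<1+N) n≢N , a)

      without-N : ¬ A N → ns Enumerates (A< suc N)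
      without-N ¬aN = record
        { unique   = unique
        ; complete = λ n → mk⇔ out (λ a → back (λ { refl → ¬aN (proj₂ a) }) a)
        }

      with-N : A N → (N ∷ ns) Enumerates (A< suc N)
      with-N aN = record
        { unique   = All.tabulate (λ n∈ns N≡n → ℕ.<-irrefl (sym N≡n)
                       (proj₁ (Equivalence.to (complete _) n∈ns))) AllPairs.∷ unique
        ; complete = λ n → mk⇔
            (λ { (here refl) → ℕ.n<1+n N , aN ; (there n∈ns) → out n∈ns })
            (split n)
        }
        where
        split : ∀ n → (A< suc N) n → n ∈ N ∷ ns
        split n a with n ℕ.≟ N
        ... | yes n≡N = here n≡N
        ... | no  n≢N = there (back n≢N a)

-- Neither P nor n ≤ℝ x is decidable in general, so an enumeration of
-- ⟨ P ⟩≤ x cannot be computed; but it always exists classically.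
enumerable : (P : Pred ℕ ℓ) (x : ℝ) → ¬ ¬ ∃ λ ns → ns Enumerates (⟨ P ⟩≤ x)
enumerable P x k = bounded-enumerable (⟨ P ⟩≤ x) N λ (ns , e) →
  k (ns , record
    { unique   = _Enumerates_.unique e
    ; complete = λ n → let open Equivalence (_Enumerates_.complete e n) in
        mk⇔ (proj₂ ∘ to) (λ a → from (bound n (proj₂ a) , a))
    })
  where
  open ℝ x
  q = proj₁ upper-inhabited
  N = suc ℤ.∣ ↥ q ∣
  bound : ∀ n → n ≤ℝ x → n ℕ.< N
  bound n n≤x = ℕ.≰⇒> λ N≤n → n≤x
    (Equivalence.from (upper-rounded (+ n / 1)) (q , <-bound q n N≤n , proj₂ upper-inhabited))

{-# OPTIONS --safe #-}

-- Let N be the largest element of ⟨P⟩ up to x. Summing over m ≤ N the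
-- identity ∑_{d ∣ m, d ∈ ⟨P⟩} μ(d) = [m has no prime factor in P] gives
-- ∑_d μ(d) ⌊N/d⌋ = C, the number of m ≤ N without prime factors in P.
-- Replacing ⌊N/d⌋ by N/d costs at most 1 for each d ≠ 1, and nothing for
-- d = 1. As no m ≠ 1 lies in ⟨P⟩ and is free of prime factors in P, the
-- total N · |∑_d μ(d)/d| ≤ C + #{d ∈ ⟨P⟩ : 1 < d ≤ N} is at most N.
module Submission where

open import Defs
open import Data.Integer.Base as ℤ using (ℤ; +_; -[1+_]; 0ℤ; -1ℤ; 1ℤ)
import Data.Integer.Properties as ℤ
open import Data.List.Base using (List; []; _∷_; [_]; length; map; filter; applyDownFrom)
open import Data.List.Extrema.Nat using (max; xs≤max; argmax-sel)
open import Data.List.Membership.Propositional using (_∈_; _∉_; find; lose)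
open import Data.List.Membership.Propositional.Properties using (∈-map⁺; ∈-map⁻; ∈-filter⁺; ∈-filter⁻; ∈-applyDownFrom⁺; ∈-applyDownFrom⁻)
open import Data.List.Membership.Propositional.Properties.WithK using (unique∧set⇒bag)
open import Data.List.Relation.Binary.BagAndSetEquality using (∼bag⇒↭)
open import Data.List.Relation.Binary.Permutation.Propositional using (_↭_; ↭⇒↭ₛ)
open import Data.List.Relation.Binary.Permutation.Propositional.Properties using (↭-length) renaming (map⁺ to ↭-map⁺)
import Data.List.Relation.Binary.Permutation.Setoid.Properties as Permutation
open import Data.List.Relation.Unary.All as All using ([]; _∷_)
open import Data.List.Relation.Unary.All.Properties using (¬Any⇒All¬)
open import Data.List.Relation.Unary.AllPairs using ([]; _∷_)
open import Data.List.Relation.Unary.Any using (here; there; any?)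
open import Data.List.Relation.Unary.Unique.Propositional using (Unique)
import Data.List.Relation.Unary.Unique.Propositional.Properties as Unique
open import Data.Nat.Base as ℕ using (ℕ; zero; suc; NonZero)
open import Data.Nat.Divisibility using (_∣_; _∤_; _∣?_; divides; ∣⇒≤; ∣-refl; ∣-trans; ∣m⇒∣m*n; ∣n⇒∣m*n; *-monoʳ-∣; *-cancelˡ-∣; ∣1⇒≡1; 1∣_; n∣m*n; m∣m*n; ∣m∣n⇒∣m+n; ∣m+n∣m⇒∣n)
open import Data.Nat.ListAction using (product)
open import Data.Nat.Primality using (Prime; prime?; prime⇒nonZero; prime⇒irreducible; euclidsLemma; ¬prime[1])
open import Data.Nat.Primality.Factorisation using (PrimeFactorisation; factorise; factorisationUnique)
import Data.Nat.Properties as ℕ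
open import Data.List.Membership.DecPropositional ℕ._≟_ using (_∈?_)
open import Data.List.Relation.Unary.Unique.DecPropositional ℕ._≟_ using (unique?)
open import Data.Product.Base using (∃; ∃₂; _×_; _,_; proj₁; proj₂)
open import Data.Rational.Base as ℚ using (ℚ; 0ℚ; 1ℚ; ∣_∣; _≤_; _/_; _+_; _*_; -_; _-_)
import Data.Rational.Properties as ℚ
open import Data.Rational.Solver using (module +-*-Solver)
open import Data.Rational.Unnormalised.Base as ℚᵘ using (mkℚᵘ; *≡*; *≤*; *<*)
import Data.Rational.Unnormalised.Properties as ℚᵘ
open import Data.Sum.Base using (inj₁; inj₂; [_,_]′)
open import Function.Base using (_∘_; id)
open import Function.Bundles using (mk⇔; Equivalence)
open import Level using (Level)
open import Relation.Binary.PropositionalEquality using (_≡_; _≢_; refl; sym; trans; cong; cong₂; subst; setoid; module ≡-Reasoning)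
open import Relation.Nullary using (¬_; Dec; yes; no; contradiction; ¬?; _×-dec_)
open import Relation.Unary using (Pred; Decidable; _⊆_)

private
  variable
    a ℓ : Level
    f g : ℕ → ℚ
    m n p d : ℕ
    ns ms : List ℕ

-- Rational numbers

ι : ℤ → ℚ
ι i = i / 1

-- `_/_` reduces to lowest terms and so does not compute on variables. The facts about `ι` below are
-- proved on unnormalised fractions, where they are integer identities or inequalities, and carried
-- back to ℚ.
toℚᵘ-/ : ∀ i d-1 → ℚ.toℚᵘ (i / suc d-1) ℚᵘ.≃ mkℚᵘ i d-1
toℚᵘ-/ i d-1 = ℚ.toℚᵘ-fromℚᵘ (mkℚᵘ i d-1)

ι-+ : ∀ i j → ι (i ℤ.+ j) ≡ ι i + ι j
ι-+ i j = ℚ.toℚᵘ-injective (begin-equality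
  ℚ.toℚᵘ (ι (i ℤ.+ j))             ≃⟨ toℚᵘ-/ (i ℤ.+ j) 0 ⟩
  mkℚᵘ (i ℤ.+ j) 0                 ≃⟨ *≡* (cong (ℤ._* 1ℤ) (sym (cong₂ ℤ._+_ (ℤ.*-identityʳ i) (ℤ.*-identityʳ j)))) ⟩
  mkℚᵘ i 0 ℚᵘ.+ mkℚᵘ j 0           ≃⟨ ℚᵘ.+-cong (toℚᵘ-/ i 0) (toℚᵘ-/ j 0) ⟨
  ℚ.toℚᵘ (ι i) ℚᵘ.+ ℚ.toℚᵘ (ι j)   ≃⟨ ℚ.toℚᵘ-homo-+ (ι i) (ι j) ⟨
  ℚ.toℚᵘ (ι i + ι j)               ∎)
  where open ℚᵘ.≤-Reasoning

ι-* : ∀ i j → ι (i ℤ.* j) ≡ ι i * ι j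
ι-* i j = ℚ.toℚᵘ-injective (begin-equality
  ℚ.toℚᵘ (ι (i ℤ.* j))             ≃⟨ toℚᵘ-/ (i ℤ.* j) 0 ⟩
  mkℚᵘ i 0 ℚᵘ.* mkℚᵘ j 0           ≃⟨ ℚᵘ.*-cong (toℚᵘ-/ i 0) (toℚᵘ-/ j 0) ⟨
  ℚ.toℚᵘ (ι i) ℚᵘ.* ℚ.toℚᵘ (ι j)   ≃⟨ ℚ.toℚᵘ-homo-* (ι i) (ι j) ⟨
  ℚ.toℚᵘ (ι i * ι j)               ∎)
  where open ℚᵘ.≤-Reasoning

ι-neg : ∀ i → ι (-1ℤ ℤ.* i) ≡ - ι i
ι-neg i = trans (ι-* -1ℤ i) (trans (sym (ℚ.neg-distribˡ-* 1ℚ (ι i))) (cong -_ (ℚ.*-identityˡ (ι i))))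

ι-mono-≤ : ∀ {i j} → i ℤ.≤ j → ι i ≤ ι j
ι-mono-≤ {i} {j} i≤j = ℚ.toℚᵘ-cancel-≤ (begin
  ℚ.toℚᵘ (ι i)  ≃⟨ toℚᵘ-/ i 0 ⟩
  mkℚᵘ i 0      ≤⟨ *≤* (ℤ.*-monoʳ-≤-nonNeg 1ℤ i≤j) ⟩
  mkℚᵘ j 0      ≃⟨ toℚᵘ-/ j 0 ⟨
  ℚ.toℚᵘ (ι j)  ∎)
  where open ℚᵘ.≤-Reasoning

ι-mono-< : ∀ {i j} → i ℤ.< j → ι i ℚ.< ι j
ι-mono-< {i} {j} i<j = ℚ.toℚᵘ-cancel-< (begin-strict
  ℚ.toℚᵘ (ι i)  ≃⟨ toℚᵘ-/ i 0 ⟩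
  mkℚᵘ i 0      <⟨ *<* (ℤ.*-monoʳ-<-pos 1ℤ i<j) ⟩
  mkℚᵘ j 0      ≃⟨ toℚᵘ-/ j 0 ⟨
  ℚ.toℚᵘ (ι j)  ∎)
  where open ℚᵘ.≤-Reasoning

/-*-cancel : ∀ i d .{{_ : NonZero d}} → ι (+ d) * (i / d) ≡ ι i
/-*-cancel i d@(suc d-1) = ℚ.toℚᵘ-injective (begin-equality
  ℚ.toℚᵘ (ι (+ d) * (i / d))              ≃⟨ ℚ.toℚᵘ-homo-* (ι (+ d)) (i / d) ⟩
  ℚ.toℚᵘ (ι (+ d)) ℚᵘ.* ℚ.toℚᵘ (i / d)    ≃⟨ ℚᵘ.*-cong (toℚᵘ-/ (+ d) 0) (toℚᵘ-/ i d-1) ⟩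
  mkℚᵘ (+ d) 0 ℚᵘ.* mkℚᵘ i d-1            ≃⟨ *≡* (trans (ℤ.*-identityʳ _) (trans (ℤ.*-comm (+ d) i) (cong (λ e → i ℤ.* + e) (sym (ℕ.*-identityˡ d))))) ⟩
  mkℚᵘ i 0                                ≃⟨ toℚᵘ-/ i 0 ⟨
  ℚ.toℚᵘ (ι i)                            ∎)
  where open ℚᵘ.≤-Reasoning

-- The Iverson bracket. It takes the decision itself, so that a proof can generalise over the
-- decision and match on it.
𝟙 : {A : Set a} → Dec A → ℚ
𝟙 (yes _) = 1ℚ
𝟙 (no  _) = 0ℚ

𝟙≢1 : ℕ → ℚ
𝟙≢1 n = 𝟙 (¬? (n ℕ.≟ 1))

0≤1ℚ : 0ℚ ≤ 1ℚ
0≤1ℚ = ℚ.nonNegative⁻¹ 1ℚ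

-- Finite sums

∑-cong : (∀ {n} → n ∈ ns → f n ≡ g n) → ∑ ns f ≡ ∑ ns g
∑-cong {[]}     f≡g = refl
∑-cong {n ∷ ns} f≡g = cong₂ _+_ (f≡g (here refl)) (∑-cong (f≡g ∘ there))

∑-↭ : ∀ f → ms ↭ ns → ∑ ms f ≡ ∑ ns f
∑-↭ f ms↭ns = Permutation.foldr-commMonoid (setoid ℚ) ℚ.+-0-isCommutativeMonoid (↭⇒↭ₛ (↭-map⁺ f ms↭ns))

∑-map : ∀ (h : ℕ → ℕ) ns f → ∑ (map h ns) f ≡ ∑ ns (f ∘ h)
∑-map h []       f = refl
∑-map h (n ∷ ns) f = cong (_+_ (f (h n))) (∑-map h ns f)

∑-0 : ∀ ns → ∑ ns (λ _ → 0ℚ) ≡ 0ℚ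
∑-0 []       = refl
∑-0 (n ∷ ns) = trans (ℚ.+-identityˡ _) (∑-0 ns)

∑-+ : ∀ ns f g → ∑ ns (λ n → f n + g n) ≡ ∑ ns f + ∑ ns g
∑-+ []       f g = refl
∑-+ (n ∷ ns) f g = trans (cong (_+_ (f n + g n)) (∑-+ ns f g))
  (solve 4 (λ a b c d → (a :+ b) :+ (c :+ d) := (a :+ c) :+ (b :+ d)) refl (f n) (g n) (∑ ns f) (∑ ns g))
  where open +-*-Solver

∑-*ˡ : ∀ ns c f → ∑ ns (λ n → c * f n) ≡ c * ∑ ns f
∑-*ˡ []       c f = sym (ℚ.*-zeroʳ c)
∑-*ˡ (n ∷ ns) c f = trans (cong (_+_ (c * f n)) (∑-*ˡ ns c f)) (sym (ℚ.*-distribˡ-+ c (f n) (∑ ns f)))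

∑-neg : ∀ ns f → ∑ ns (λ n → - f n) ≡ - ∑ ns f
∑-neg []       f = refl
∑-neg (n ∷ ns) f = trans (cong (_+_ (- f n)) (∑-neg ns f)) (sym (ℚ.neg-distrib-+ (f n) (∑ ns f)))

∑-swap : ∀ ms ns (h : ℕ → ℕ → ℚ) → ∑ ms (λ m → ∑ ns (h m)) ≡ ∑ ns (λ n → ∑ ms (λ m → h m n))
∑-swap []       ns h = sym (∑-0 ns)
∑-swap (m ∷ ms) ns h = trans (cong (_+_ (∑ ns (h m))) (∑-swap ms ns h)) (sym (∑-+ ns (h m) _))

∑-filter : ∀ {P : Pred ℕ ℓ} (P? : Decidable P) ns f → ∑ (filter P? ns) f ≡ ∑ ns (λ n → 𝟙 (P? n) * f n)
∑-filter P? []       f = refl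
∑-filter P? (n ∷ ns) f with P? n
... | yes _ = cong₂ _+_ (sym (ℚ.*-identityˡ (f n))) (∑-filter P? ns f)
... | no  _ = trans (∑-filter P? ns f) (sym (trans (cong (_+ _) (ℚ.*-zeroˡ (f n))) (ℚ.+-identityˡ _)))

∑-partition : ∀ {P : Pred ℕ ℓ} (P? : Decidable P) ns f → ∑ ns f ≡ ∑ (filter P? ns) f + ∑ (filter (¬? ∘ P?) ns) f
∑-partition P? []       f = refl
∑-partition P? (n ∷ ns) f with P? n
... | yes _ = trans (cong (_+_ (f n)) (∑-partition P? ns f)) (sym (ℚ.+-assoc (f n) _ _))
... | no  _ = trans (cong (_+_ (f n)) (∑-partition P? ns f))
  (solve 3 (λ a b c → a :+ (b :+ c) := b :+ (a :+ c)) refl (f n) (∑ (filter P? ns) f) (∑ (filter (¬? ∘ P?) ns) f))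
  where open +-*-Solver

∣∑∣≤∑ : (∀ {n} → n ∈ ns → ∣ f n ∣ ≤ g n) → ∣ ∑ ns f ∣ ≤ ∑ ns g
∣∑∣≤∑ {[]}         f≤g = ℚ.≤-refl
∣∑∣≤∑ {n ∷ ns} {f} f≤g = ℚ.≤-trans (ℚ.∣p+q∣≤∣p∣+∣q∣ (f n) (∑ ns f))
  (ℚ.+-mono-≤ (f≤g (here refl)) (∣∑∣≤∑ (f≤g ∘ there)))

-- Used to reindex sums: once two index sets are known to agree, `∑-↭` carries the sum from one list
-- to the other.
unique∧⇔⇒↭ : Unique ms → Unique ns → (∀ {n} → n ∈ ms → n ∈ ns) → (∀ {n} → n ∈ ns → n ∈ ms) → ms ↭ ns
unique∧⇔⇒↭ ums uns to from = ∼bag⇒↭ (unique∧set⇒bag ums uns (mk⇔ to from))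

-- Multiples of d among 1, …, N

[1⋯_] : ℕ → List ℕ
[1⋯ N ] = applyDownFrom suc N

∈-[1⋯]⁺ : .{{NonZero n}} → n ℕ.≤ m → n ∈ [1⋯ m ]
∈-[1⋯]⁺ {suc n} n≤m = ∈-applyDownFrom⁺ suc n≤m

∈-[1⋯]⁻ : n ∈ [1⋯ m ] → NonZero n × n ℕ.≤ m
∈-[1⋯]⁻ n∈ with _ , i<m , refl ← ∈-applyDownFrom⁻ suc n∈ = _ , i<m

[1⋯]-unique : ∀ N → Unique [1⋯ N ]
[1⋯]-unique N = Unique.applyDownFrom⁺₁ suc N λ j<i _ eq → ℕ.<-irrefl (sym (ℕ.suc-injective eq)) j<i

ι-suc : ∀ n → 1ℚ + ι (+ n) ≡ ι (+ suc n)
ι-suc n = sym (ι-+ 1ℤ (+ n))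

∑[1⋯]-1 : ∀ N → ∑ [1⋯ N ] (λ _ → 1ℚ) ≡ ι (+ N)
∑[1⋯]-1 zero    = refl
∑[1⋯]-1 (suc N) = trans (cong (_+_ 1ℚ) (∑[1⋯]-1 N)) (ι-suc N)

-- Here `c` is ⌊N/d⌋ and `r` the remainder. Counting and division with remainder advance together by
-- induction on `N`: a new multiple appears exactly when the remainder would reach `d`.
multiples : ∀ d .{{_ : NonZero d}} N →
            ∃₂ λ c r → ∑ [1⋯ N ] (λ m → 𝟙 (d ∣? m)) ≡ ι (+ c) × N ≡ c ℕ.* d ℕ.+ r × r ℕ.< d
multiples d zero    = 0 , 0 , refl , refl , ℕ.>-nonZero⁻¹ d
multiples d (suc N) with multiples d N
... | c , r , ∑≡c , N≡ , r<d = step (d ∣? suc N)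
  where
  1+N≡ : suc N ≡ c ℕ.* d ℕ.+ suc r
  1+N≡ = trans (cong suc N≡) (sym (ℕ.+-suc (c ℕ.* d) r))

  step : (d∣? : Dec (d ∣ suc N)) →
         ∃₂ λ c r → 𝟙 d∣? + ∑ [1⋯ N ] (λ m → 𝟙 (d ∣? m)) ≡ ι (+ c) × suc N ≡ c ℕ.* d ℕ.+ r × r ℕ.< d
  step (yes d∣) = suc c , 0 , trans (cong (_+_ 1ℚ) ∑≡c) (ι-suc c) , eq , ℕ.>-nonZero⁻¹ d
    where
    -- `d` divides both `suc N` and `c * d`, hence also `suc r`, which is at most `d`.
    1+r≡d : suc r ≡ d
    1+r≡d = ℕ.≤-antisym r<d (∣⇒≤ (∣m+n∣m⇒∣n (subst (d ∣_) 1+N≡ d∣) (n∣m*n c)))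
    eq : suc N ≡ suc c ℕ.* d ℕ.+ 0
    eq = trans 1+N≡ (trans (cong (c ℕ.* d ℕ.+_) 1+r≡d) (trans (ℕ.+-comm (c ℕ.* d) d) (sym (ℕ.+-identityʳ _))))
  step (no d∤) = c , suc r , trans (ℚ.+-identityˡ _) ∑≡c , 1+N≡ , ℕ.≤∧≢⇒< r<d λ 1+r≡d →
    d∤ (subst (d ∣_) (sym 1+N≡) (∣m∣n⇒∣m+n (n∣m*n c) (subst (d ∣_) (sym 1+r≡d) ∣-refl)))

-- The Möbius function

Unique-resp-↭ : ms ↭ ns → Unique ms → Unique ns
Unique-resp-↭ ms↭ns = Permutation.Unique-resp-↭ (setoid ℕ) (↭⇒↭ₛ ms↭ns)

open PrimeFactorisation

-- `μ` is defined by the factorisation that `factorise` returns. As factorisations agree up to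
-- permutation, any other one may be used to evaluate it, in particular one with a prime put in
-- front.
μ-unique : .{{_ : NonZero n}} (F : PrimeFactorisation n) → Unique (factors F) → μ n ≡ -1ℤ ℤ.^ length (factors F)
μ-unique {suc n-1} F u with unique? (factors (factorise (suc n-1)))
... | yes _ = cong (-1ℤ ℤ.^_) (↭-length (factorisationUnique (factorise (suc n-1)) F))
... | no ¬u = contradiction (Unique-resp-↭ (factorisationUnique F (factorise (suc n-1))) u) ¬u

μ-¬unique : .{{_ : NonZero n}} (F : PrimeFactorisation n) → ¬ Unique (factors F) → μ n ≡ 0ℤ
μ-¬unique {suc n-1} F ¬u with unique? (factors (factorise (suc n-1)))
... | yes u = contradiction (Unique-resp-↭ (factorisationUnique (factorise (suc n-1)) F) u) ¬u
... | no _  = refl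

prime∷factorisation : Prime p → PrimeFactorisation n → PrimeFactorisation (p ℕ.* n)
prime∷factorisation {p} pp F = record
  { factors         = p ∷ factors F
  ; isFactorisation = cong (p ℕ.*_) (isFactorisation F)
  ; factorsPrime    = pp ∷ factorsPrime F
  }

∈-factors⇒∣ : ∀ {as} → p ∈ as → p ∣ product as
∈-factors⇒∣ {as = a ∷ as} (here refl) = m∣m*n (product as)
∈-factors⇒∣ {as = a ∷ as} (there p∈)  = ∣n⇒∣m*n a (∈-factors⇒∣ p∈)

-- Putting `p` in front of the factors of `n` creates no repetition, removes none, and lengthens the
-- list by one.
μ[p*n]≡-μ[n] : .{{_ : NonZero n}} → Prime p → p ∤ n → μ (p ℕ.* n) ≡ -1ℤ ℤ.* μ n
μ[p*n]≡-μ[n] {n} {p} pp p∤n = go (unique? (factors F))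
  where
  instance
    _ = prime⇒nonZero pp
    _ = ℕ.m*n≢0 p n
  F = factorise n
  pF = prime∷factorisation pp F
  p∉F : p ∉ factors F
  p∉F p∈F = p∤n (subst (p ∣_) (sym (isFactorisation F)) (∈-factors⇒∣ p∈F))
  go : Dec (Unique (factors F)) → μ (p ℕ.* n) ≡ -1ℤ ℤ.* μ n
  go (yes u) = trans (μ-unique pF (¬Any⇒All¬ _ p∉F ∷ u)) (cong (-1ℤ ℤ.*_) (sym (μ-unique F u)))
  go (no ¬u) = trans (μ-¬unique pF λ { (_ ∷ u) → ¬u u }) (cong (-1ℤ ℤ.*_) (sym (μ-¬unique F ¬u)))

-- Two copies of `p` followed by the factors of the quotient form a factorisation with a repeated
-- entry.
p²∣n⇒μ[n]≡0 : .{{_ : NonZero n}} → Prime p → p ℕ.* p ∣ n → μ n ≡ 0ℤ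
p²∣n⇒μ[n]≡0 {n} {p} pp (divides q refl) = subst (λ k → μ k ≡ 0ℤ) p[pq]≡n
  (μ-¬unique (prime∷factorisation pp (prime∷factorisation pp (factorise q))) λ { ((p≢p ∷ _) ∷ _) → p≢p refl })
  where
  p[pq]≡n : p ℕ.* (p ℕ.* q) ≡ q ℕ.* (p ℕ.* p)
  p[pq]≡n = trans (sym (ℕ.*-assoc p p q)) (ℕ.*-comm (p ℕ.* p) q)
  instance
    _ = ℕ.m*n≢0⇒m≢0 q
    _ = prime⇒nonZero pp
    _ = ℕ.m*n≢0 p q
    _ = ℕ.m*n≢0 p (p ℕ.* q)

∣-1^n∣≡1 : ∀ n → ℤ.∣ -1ℤ ℤ.^ n ∣ ≡ 1
∣-1^n∣≡1 zero    = refl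
∣-1^n∣≡1 (suc n) = trans (ℤ.abs-* -1ℤ (-1ℤ ℤ.^ n)) (trans (ℕ.*-identityˡ _) (∣-1^n∣≡1 n))

∣μ∣≤1 : ∀ n → ℤ.∣ μ n ∣ ℕ.≤ 1
∣μ∣≤1 zero = ℕ.z≤n
∣μ∣≤1 (suc n-1) with unique? (factors (factorise (suc n-1)))
... | yes _ = ℕ.≤-reflexive (∣-1^n∣≡1 (length (factors (factorise (suc n-1)))))
... | no  _ = ℕ.z≤n

∣ι∣≤1 : ∀ i → ℤ.∣ i ∣ ℕ.≤ 1 → ∣ ι i ∣ ≤ 1ℚ
∣ι∣≤1 (+ 0)    _ = 0≤1ℚ
∣ι∣≤1 (+ 1)    _ = ℚ.≤-refl
∣ι∣≤1 -[1+ 0 ] _ = ℚ.≤-refl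
∣ι∣≤1 (+ suc (suc _))  (ℕ.s≤s ())
∣ι∣≤1 -[1+ suc _ ]     (ℕ.s≤s ())

prime-factor : .{{_ : NonZero n}} → n ≢ 1 → ∃ λ p → Prime p × p ∣ n
prime-factor {n} n≢1 with factorise n
... | record { factors = []     ; isFactorisation = n≡1 } = contradiction n≡1 n≢1
... | record { factors = p ∷ as ; isFactorisation = n≡  ; factorsPrime = pp ∷ _ } =
  p , pp , subst (p ∣_) (sym n≡) (m∣m*n (product as))

prime∣prime⇒≡ : ∀ {q} → Prime p → Prime q → q ∣ p → q ≡ p
prime∣prime⇒≡ pp pq q∣p with prime⇒irreducible pp q∣p
... | inj₁ refl = contradiction pq ¬prime[1]
... | inj₂ q≡p  = q≡p

-- Writing `N` as `c * d + r` with `r < d`, the difference is `r` times μ(d)/d. It is less than one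
-- in absolute value, and for `d = 1` the remainder is zero.
multiples-error : ∀ N d .{{_ : NonZero d}} →
  ∣ ι (+ N) * μ[n]/n d - ι (μ d) * ∑ [1⋯ N ] (λ m → 𝟙 (d ∣? m)) ∣ ≤ 𝟙≢1 d
multiples-error N d@(suc _) with multiples d N
... | c , r , ∑≡c , N≡ , r<d = subst (λ e → ∣ e ∣ ≤ 𝟙≢1 d) (sym error≡r*y) (bound (d ℕ.≟ 1))
  where
  y = μ[n]/n d
  error≡r*y : ι (+ N) * y - ι (μ d) * ∑ [1⋯ N ] (λ m → 𝟙 (d ∣? m)) ≡ ι (+ r) * y
  error≡r*y = begin
    ι (+ N) * y - ι (μ d) * ∑ [1⋯ N ] (λ m → 𝟙 (d ∣? m))
      ≡⟨ cong₂ (λ s t → s * y - ι (μ d) * t) (trans (cong (ι ∘ +_) N≡) ι[cd+r]) ∑≡c ⟩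
    (ι (+ c) * ι (+ d) + ι (+ r)) * y - ι (μ d) * ι (+ c)
      -- Writing `μ d` as `d * y` turns the claim into a polynomial identity in `c`, `d`, `r` and
      -- `y`.
      ≡⟨ cong (λ s → (ι (+ c) * ι (+ d) + ι (+ r)) * y - s * ι (+ c)) (sym (/-*-cancel (μ d) d)) ⟩
    (ι (+ c) * ι (+ d) + ι (+ r)) * y - (ι (+ d) * y) * ι (+ c)
      ≡⟨ solve 4 (λ c d r y → (c :* d :+ r) :* y :- (d :* y) :* c := r :* y) refl (ι (+ c)) (ι (+ d)) (ι (+ r)) y ⟩
    ι (+ r) * y ∎
    where
    open ≡-Reasoning
    open +-*-Solver
    ι[cd+r] : ι (+ (c ℕ.* d ℕ.+ r)) ≡ ι (+ c) * ι (+ d) + ι (+ r)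
    ι[cd+r] = trans (ι-+ (+ (c ℕ.* d)) (+ r))
      (cong (_+ ι (+ r)) (trans (cong ι (ℤ.pos-* c d)) (ι-* (+ c) (+ d))))

  0≤ι : ∀ k → 0ℚ ≤ ι (+ k)
  0≤ι k = ι-mono-≤ {0ℤ} {+ k} (ℤ.+≤+ ℕ.z≤n)

  ∣ι*y∣ : ∀ k → ∣ ι (+ k) * y ∣ ≡ ι (+ k) * ∣ y ∣
  ∣ι*y∣ k = trans (ℚ.∣p*q∣≡∣p∣*∣q∣ (ι (+ k)) y) (cong (_* ∣ y ∣) (ℚ.0≤p⇒∣p∣≡p (0≤ι k)))

  bound : (d≟1 : Dec (d ≡ 1)) → ∣ ι (+ r) * y ∣ ≤ 𝟙 (¬? d≟1)
  bound (yes d≡1) = ℚ.≤-reflexive (cong ∣_∣ (trans (cong (λ k → ι (+ k) * y) (ℕ.n<1⇒n≡0 (subst (r ℕ.<_) d≡1 r<d))) (ℚ.*-zeroˡ y)))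
  -- Enlarging `r` to `d` cancels the denominator of `y` and leaves `μ d`.
  bound (no  _)   = begin
    ∣ ι (+ r) * y ∣    ≡⟨ ∣ι*y∣ r ⟩
    ι (+ r) * ∣ y ∣    ≤⟨ ℚ.*-monoʳ-≤-nonNeg ∣ y ∣ {{ℚ.nonNegative (ℚ.0≤∣p∣ y)}} (ι-mono-≤ (ℤ.+≤+ (ℕ.<⇒≤ r<d))) ⟩
    ι (+ d) * ∣ y ∣    ≡⟨ ∣ι*y∣ d ⟨
    ∣ ι (+ d) * y ∣    ≡⟨ cong ∣_∣ (/-*-cancel (μ d) d) ⟩
    ∣ ι (μ d) ∣        ≤⟨ ∣ι∣≤1 (μ d) (∣μ∣≤1 d) ⟩
    1ℚ                 ∎
    where open ℚ.≤-Reasoning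

-- The sum over an initial segment of ⟨P⟩

-- ns lists the n ≤ N all of whose prime factors lie in a set P; since those
-- primes are themselves in ns, no reference to P is needed, and membership
-- in P becomes decidable.
record SmoothUpTo (N : ℕ) (ns : List ℕ) : Set where
  field
    unique  : Unique ns
    nonZero : n ∈ ns → NonZero n
    bounded : n ∈ ns → n ℕ.≤ N
    sound   : n ∈ ns → Prime p → p ∣ n → p ∈ ns
    closed  : .{{NonZero n}} → n ℕ.≤ N → (∀ {p} → Prime p → p ∣ n → p ∈ ns) → n ∈ ns

module _ {N : ℕ} {ns : List ℕ} (smooth : SmoothUpTo N ns) where
  open SmoothUpTo smooth

  divisors : ℕ → List ℕ
  divisors m = filter (_∣? m) ns

  -- Pairs d with p d for p ∤ d; the remaining terms vanish.
  ∑μ≡0 : ∀ m .{{_ : NonZero m}} → m ℕ.≤ N → p ∈ ns → Prime p → p ∣ m → ∑ (divisors m) (ι ∘ μ) ≡ 0ℚ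
  ∑μ≡0 {p} m m≤N p∈ns pp p∣m = begin
    ∑ (divisors m) (ι ∘ μ)
      ≡⟨ ∑-partition (p ∣?_) (divisors m) (ι ∘ μ) ⟩
    ∑ B (ι ∘ μ) + ∑ A (ι ∘ μ)
      ≡⟨ cong (_+ ∑ A (ι ∘ μ)) (∑-partition (p ℕ.* p ∣?_) B (ι ∘ μ)) ⟩
    (∑ B₀ (ι ∘ μ) + ∑ B₁ (ι ∘ μ)) + ∑ A (ι ∘ μ)
      ≡⟨ cong₂ (λ s t → (s + t) + ∑ A (ι ∘ μ)) ∑B₀≡0 ∑B₁≡-∑A ⟩
    (0ℚ - ∑ A (ι ∘ μ)) + ∑ A (ι ∘ μ)
      ≡⟨ solve 1 (λ a → (con 0ℚ :- a) :+ a := con 0ℚ) refl (∑ A (ι ∘ μ)) ⟩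
    0ℚ ∎
    where
    open ≡-Reasoning
    open +-*-Solver
    instance _ = prime⇒nonZero pp
    -- Multiplication by `p` maps `A` bijectively onto `B₁` and changes the sign of `μ`, while `μ`
    -- vanishes on `B₀`.
    A B B₀ B₁ : List ℕ
    A  = filter (¬? ∘ (p ∣?_)) (divisors m)
    B  = filter (p ∣?_) (divisors m)
    B₀ = filter (p ℕ.* p ∣?_) B
    B₁ = filter (¬? ∘ (p ℕ.* p ∣?_)) B

    ∈-A⁻ : d ∈ A → d ∈ ns × d ∣ m × p ∤ d
    ∈-A⁻ d∈A with ∈-filter⁻ (¬? ∘ (p ∣?_)) d∈A
    ... | d∈D , p∤d with ∈-filter⁻ (_∣? m) d∈D
    ... | d∈ns , d∣m = d∈ns , d∣m , p∤d

    ∈-B⁻ : d ∈ B → d ∈ ns × (d ∣ m) × (p ∣ d)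
    ∈-B⁻ d∈B with ∈-filter⁻ (p ∣?_) d∈B
    ... | d∈D , p∣d with ∈-filter⁻ (_∣? m) d∈D
    ... | d∈ns , d∣m = d∈ns , d∣m , p∣d

    ∑B₀≡0 : ∑ B₀ (ι ∘ μ) ≡ 0ℚ
    ∑B₀≡0 = trans (∑-cong term) (∑-0 B₀)
      where
      term : d ∈ B₀ → ι (μ d) ≡ 0ℚ
      term d∈B₀ with ∈-filter⁻ (p ℕ.* p ∣?_) d∈B₀
      ... | d∈B , p²∣d = cong ι (p²∣n⇒μ[n]≡0 {{nonZero (proj₁ (∈-B⁻ d∈B))}} pp p²∣d)

    to : d ∈ B₁ → d ∈ map (p ℕ.*_) A
    to d∈B₁ with ∈-filter⁻ (¬? ∘ (p ℕ.* p ∣?_)) d∈B₁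
    ... | d∈B , p²∤d with ∈-B⁻ d∈B
    ... | d∈ns , d∣m , divides e refl = subst (_∈ map (p ℕ.*_) A) (ℕ.*-comm p e)
      (∈-map⁺ (p ℕ.*_) (∈-filter⁺ (¬? ∘ (p ∣?_)) (∈-filter⁺ (_∣? m) e∈ns (∣-trans (m∣m*n p) d∣m)) p∤e))
      where
      instance
        _ = nonZero d∈ns
        _ = ℕ.m*n≢0⇒m≢0 e
      -- The prime factors of `e` also divide `e * p`, which is listed; so they are listed, and
      -- `closed` applies.
      e∈ns : e ∈ ns
      e∈ns = closed (ℕ.≤-trans (∣⇒≤ (m∣m*n p)) (bounded d∈ns))
        λ pq q∣e → sound d∈ns pq (∣m⇒∣m*n p q∣e)
      p∤e : p ∤ e
      p∤e p∣e = p²∤d (subst (p ℕ.* p ∣_) (ℕ.*-comm p e) (*-monoʳ-∣ p p∣e))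

    from : d ∈ map (p ℕ.*_) A → d ∈ B₁
    from d∈ with ∈-map⁻ (p ℕ.*_) d∈
    ... | e , e∈A , refl with ∈-A⁻ e∈A
    ... | e∈ns , divides k refl , p∤e =
      ∈-filter⁺ (¬? ∘ (p ℕ.* p ∣?_))
        (∈-filter⁺ (p ∣?_) (∈-filter⁺ (_∣? m) pe∈ns pe∣m) (m∣m*n e))
        (p∤e ∘ *-cancelˡ-∣ p)
      where
      instance
        _ = nonZero e∈ns
        _ = ℕ.m*n≢0 p e
      -- Here `m` is `k * e`. The prime `p` divides it but not `e`, so `p` divides `k`.
      pe∣m : p ℕ.* e ∣ k ℕ.* e
      pe∣m with euclidsLemma k e pp p∣m
      ... | inj₁ (divides j refl) = divides j (ℕ.*-assoc j p e)
      ... | inj₂ p∣e = contradiction p∣e p∤e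
      -- As a divisor of `m`, the product is at most `N`; each of its prime factors is `p` or a
      -- prime factor of `e`.
      pe∈ns : p ℕ.* e ∈ ns
      pe∈ns = closed (ℕ.≤-trans (∣⇒≤ pe∣m) m≤N) λ pq q∣pe →
        [ (λ q∣p → subst (_∈ ns) (sym (prime∣prime⇒≡ pp pq q∣p)) p∈ns) , sound e∈ns pq ]′ (euclidsLemma p e pq q∣pe)

    A-unique : Unique A
    A-unique = Unique.filter⁺ (¬? ∘ (p ∣?_)) (Unique.filter⁺ (_∣? m) unique)

    B₁-unique : Unique B₁
    B₁-unique = Unique.filter⁺ (¬? ∘ (p ℕ.* p ∣?_)) (Unique.filter⁺ (p ∣?_) (Unique.filter⁺ (_∣? m) unique))

    ∑B₁≡-∑A : ∑ B₁ (ι ∘ μ) ≡ - ∑ A (ι ∘ μ)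
    ∑B₁≡-∑A = begin
      ∑ B₁ (ι ∘ μ)                ≡⟨ ∑-↭ (ι ∘ μ) (unique∧⇔⇒↭ B₁-unique (Unique.map⁺ (ℕ.*-cancelˡ-≡ _ _ p) A-unique) to from) ⟩
      ∑ (map (p ℕ.*_) A) (ι ∘ μ)  ≡⟨ ∑-map (p ℕ.*_) A (ι ∘ μ) ⟩
      ∑ A (ι ∘ μ ∘ (p ℕ.*_))      ≡⟨ ∑-cong term ⟩
      ∑ A (λ d → - ι (μ d))       ≡⟨ ∑-neg A (ι ∘ μ) ⟩
      - ∑ A (ι ∘ μ)               ∎
      where
      term : d ∈ A → ι (μ (p ℕ.* d)) ≡ - ι (μ d)
      term {d} d∈A with ∈-A⁻ d∈A
      ... | d∈ns , _ , p∤d = trans (cong ι (μ[p*n]≡-μ[n] {{nonZero d∈ns}} pp p∤d)) (ι-neg (μ d))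

  1∈ns : .{{NonZero N}} → 1 ∈ ns
  1∈ns = closed (ℕ.>-nonZero⁻¹ N) λ pp p∣1 → contradiction (subst Prime (∣1⇒≡1 p∣1) pp) ¬prime[1]

  -- Only the divisor 1 survives: any other listed divisor has a prime factor, and that prime would
  -- be listed and divide `m`.
  ∑μ≡1 : ∀ m .{{_ : NonZero m}} → m ℕ.≤ N → (∀ {p} → p ∈ ns → Prime p → p ∤ m) → ∑ (divisors m) (ι ∘ μ) ≡ 1ℚ
  -- The sum over `[ 1 ]` evaluates to `1ℚ` by computation.
  ∑μ≡1 m m≤N p∤m = ∑-↭ (ι ∘ μ) (unique∧⇔⇒↭ (Unique.filter⁺ (_∣? m) unique) ([] ∷ []) to from)
    where
    to : d ∈ divisors m → d ∈ [ 1 ]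
    to {d} d∈ with ∈-filter⁻ (_∣? m) d∈ | d ℕ.≟ 1
    ... | _          | yes d≡1 = here d≡1
    ... | d∈ns , d∣m | no  d≢1 with prime-factor {{nonZero d∈ns}} d≢1
    ...   | p , pp , p∣d = contradiction (∣-trans p∣d d∣m) (p∤m (sound d∈ns pp p∣d) pp)
    from : d ∈ [ 1 ] → d ∈ divisors m
    from (here refl) = ∈-filter⁺ (_∣? m) (1∈ns {{ℕ.>-nonZero (ℕ.≤-trans (ℕ.>-nonZero⁻¹ m) m≤N)}}) (1∣ m)

  -- The subtracted term makes room for the rounding error at `d = m`. If a listed prime divides
  -- `m`, the sum is 0 and the right side is nonnegative. Otherwise the sum is 1 and nothing may be
  -- subtracted: a listed `m` other than 1 would have a listed prime factor.
  ∣∑μ∣≤ : ∀ m .{{_ : NonZero m}} → m ℕ.≤ N → ∣ ∑ (divisors m) (ι ∘ μ) ∣ ≤ 1ℚ - 𝟙 (m ∈? ns) * 𝟙≢1 m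
  ∣∑μ∣≤ m m≤N with any? (λ p → prime? p ×-dec (p ∣? m)) ns
  ... | yes ∃p with find ∃p
  ...   | p , p∈ns , pp , p∣m = subst (λ s → ∣ s ∣ ≤ 1ℚ - 𝟙 (m ∈? ns) * 𝟙≢1 m) (sym (∑μ≡0 m m≤N p∈ns pp p∣m))
    (0≤1-𝟙𝟙 (m ∈? ns) (¬? (m ℕ.≟ 1)))
    where
    0≤1-𝟙𝟙 : ∀ {A B : Set} (A? : Dec A) (B? : Dec B) → 0ℚ ≤ 1ℚ - 𝟙 A? * 𝟙 B?
    0≤1-𝟙𝟙 (yes _) (yes _) = ℚ.≤-refl
    0≤1-𝟙𝟙 (yes _) (no  _) = 0≤1ℚ
    0≤1-𝟙𝟙 (no  _) (yes _) = 0≤1ℚ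
    0≤1-𝟙𝟙 (no  _) (no  _) = 0≤1ℚ
  ∣∑μ∣≤ m m≤N | no ∄p = subst (λ s → ∣ s ∣ ≤ 1ℚ - 𝟙 (m ∈? ns) * 𝟙≢1 m)
    (sym (∑μ≡1 m m≤N λ p∈ns pp p∣m → ∄p (lose p∈ns (pp , p∣m)))) (1≤ (m ∈? ns) (m ℕ.≟ 1))
    where
    1≤ : (∈? : Dec (m ∈ ns)) (≟1 : Dec (m ≡ 1)) → 1ℚ ≤ 1ℚ - 𝟙 ∈? * 𝟙 (¬? ≟1)
    1≤ (yes _)    (yes _)  = ℚ.≤-refl
    1≤ (no  _)    (yes _)  = ℚ.≤-refl
    1≤ (no  _)    (no  _)  = ℚ.≤-refl
    1≤ (yes m∈ns) (no m≢1) with prime-factor m≢1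
    ... | p , pp , p∣m = contradiction (lose (sound m∈ns pp p∣m) (pp , p∣m)) ∄p

  private
    R = [1⋯ N ]

    -- This is ⌊N/d⌋, kept as a sum over `m` so that the order of summation can be exchanged.
    c : ℕ → ℚ
    c d = ∑ R (λ m → 𝟙 (d ∣? m))

  -- Spreads the rounding errors over all of 1, ..., N, where they can be added term by term to the
  -- bounds of `∣∑μ∣≤`.
  ∑𝟙≢1 : ∑ ns 𝟙≢1 ≡ ∑ R (λ m → 𝟙 (m ∈? ns) * 𝟙≢1 m)
  ∑𝟙≢1 = trans (∑-↭ 𝟙≢1 (unique∧⇔⇒↭ unique (Unique.filter⁺ (_∈? ns) ([1⋯]-unique N))
      (λ n∈ns → ∈-filter⁺ (_∈? ns) (∈-[1⋯]⁺ {{nonZero n∈ns}} (bounded n∈ns)) n∈ns)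
      (λ n∈ → proj₂ (∈-filter⁻ (_∈? ns) {xs = [1⋯ N ]} n∈))))
    (∑-filter (_∈? ns) R 𝟙≢1)

  -- Double counting of the pairs of a listed `d` and a multiple `m` of it up to `N`, each weighted
  -- by `μ d`.
  ∑-swap-divisors : ∑ ns (λ d → ι (μ d) * c d) ≡ ∑ R (λ m → ∑ (divisors m) (ι ∘ μ))
  ∑-swap-divisors = begin
    ∑ ns (λ d → ι (μ d) * c d)                          ≡⟨ ∑-cong {ns} (λ {d} _ → sym (∑-*ˡ R (ι (μ d)) _)) ⟩
    ∑ ns (λ d → ∑ R (λ m → ι (μ d) * 𝟙 (d ∣? m)))       ≡⟨ ∑-swap ns R _ ⟩
    ∑ R (λ m → ∑ ns (λ d → ι (μ d) * 𝟙 (d ∣? m)))       ≡⟨ ∑-cong {R} (λ {m} _ → ∑-cong {ns} (λ {d} _ → ℚ.*-comm (ι (μ d)) (𝟙 (d ∣? m)))) ⟩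
    ∑ R (λ m → ∑ ns (λ d → 𝟙 (d ∣? m) * ι (μ d)))       ≡⟨ ∑-cong {R} (λ {m} _ → sym (∑-filter (_∣? m) ns (ι ∘ μ))) ⟩
    ∑ R (λ m → ∑ (divisors m) (ι ∘ μ))                  ∎
    where open ≡-Reasoning

  ∣N*∑∣≤N : ∣ ι (+ N) * ∑ ns μ[n]/n ∣ ≤ ι (+ N)
  ∣N*∑∣≤N = begin
    ∣ ι (+ N) * ∑ ns μ[n]/n ∣
      ≡⟨ cong ∣_∣ decompose ⟩
    ∣ ∑ ns error + ∑ R (λ m → ∑ (divisors m) (ι ∘ μ)) ∣
      ≤⟨ ℚ.∣p+q∣≤∣p∣+∣q∣ (∑ ns error) (∑ R (λ m → ∑ (divisors m) (ι ∘ μ))) ⟩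
    ∣ ∑ ns error ∣ + ∣ ∑ R (λ m → ∑ (divisors m) (ι ∘ μ)) ∣
      ≤⟨ ℚ.+-mono-≤
           (∣∑∣≤∑ {ns} λ {d} d∈ns → multiples-error N d {{nonZero d∈ns}})
           (∣∑∣≤∑ {R} λ {m} m∈R → ∣∑μ∣≤ m {{proj₁ (∈-[1⋯]⁻ m∈R)}} (proj₂ (∈-[1⋯]⁻ m∈R))) ⟩
    ∑ ns 𝟙≢1 + ∑ R (λ m → 1ℚ - 𝟙 (m ∈? ns) * 𝟙≢1 m)
      ≡⟨ cong (_+ ∑ R (λ m → 1ℚ - 𝟙 (m ∈? ns) * 𝟙≢1 m)) ∑𝟙≢1 ⟩
    ∑ R (λ m → 𝟙 (m ∈? ns) * 𝟙≢1 m) + ∑ R (λ m → 1ℚ - 𝟙 (m ∈? ns) * 𝟙≢1 m)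
      ≡⟨ ∑-+ R _ _ ⟨
    ∑ R (λ m → 𝟙 (m ∈? ns) * 𝟙≢1 m + (1ℚ - 𝟙 (m ∈? ns) * 𝟙≢1 m))
      -- For each `m`, the rounding error and the bound on the divisor sum add up to exactly one.
      ≡⟨ ∑-cong {R} (λ {m} _ → solve 1 (λ b → b :+ (con 1ℚ :- b) := con 1ℚ) refl (𝟙 (m ∈? ns) * 𝟙≢1 m)) ⟩
    ∑ R (λ _ → 1ℚ)
      ≡⟨ ∑[1⋯]-1 N ⟩
    ι (+ N) ∎
    where
    open ℚ.≤-Reasoning
    open +-*-Solver
    error : ℕ → ℚ
    error d = ι (+ N) * μ[n]/n d - ι (μ d) * c d
    decompose : ι (+ N) * ∑ ns μ[n]/n ≡ ∑ ns error + ∑ R (λ m → ∑ (divisors m) (ι ∘ μ))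
    decompose = begin-equality
      ι (+ N) * ∑ ns μ[n]/n                            ≡⟨ ∑-*ˡ ns (ι (+ N)) μ[n]/n ⟨
      ∑ ns (λ d → ι (+ N) * μ[n]/n d)                  ≡⟨ ∑-cong {ns} (λ {d} _ → solve 2 (λ a b → a := (a :- b) :+ b) refl (ι (+ N) * μ[n]/n d) (ι (μ d) * c d)) ⟩
      ∑ ns (λ d → error d + ι (μ d) * c d)             ≡⟨ ∑-+ ns error _ ⟩
      ∑ ns error + ∑ ns (λ d → ι (μ d) * c d)          ≡⟨ cong (_+_ (∑ ns error)) ∑-swap-divisors ⟩
      ∑ ns error + ∑ R (λ m → ∑ (divisors m) (ι ∘ μ))  ∎

  ∣∑∣≤1 : .{{NonZero N}} → ∣ ∑ ns μ[n]/n ∣ ≤ 1ℚ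
  ∣∑∣≤1 = ℚ.*-cancelˡ-≤-pos (ι (+ N)) {{ℚ.positive 0<N}} (begin
    ι (+ N) * ∣ ∑ ns μ[n]/n ∣      ≡⟨ cong (_* ∣ ∑ ns μ[n]/n ∣) (ℚ.0≤p⇒∣p∣≡p (ℚ.<⇒≤ 0<N)) ⟨
    ∣ ι (+ N) ∣ * ∣ ∑ ns μ[n]/n ∣  ≡⟨ ℚ.∣p*q∣≡∣p∣*∣q∣ (ι (+ N)) (∑ ns μ[n]/n) ⟨
    ∣ ι (+ N) * ∑ ns μ[n]/n ∣      ≤⟨ ∣N*∑∣≤N ⟩
    ι (+ N)                        ≡⟨ ℚ.*-identityʳ (ι (+ N)) ⟨
    ι (+ N) * 1ℚ                   ∎)
    where
    open ℚ.≤-Reasoning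
    0<N : 0ℚ ℚ.< ι (+ N)
    0<N = ι-mono-< (ℤ.+<+ (ℕ.>-nonZero⁻¹ N))

-- From the real bound x to the largest listed number

≤ℝ-downward : ∀ (x : ℝ) → m ℕ.≤ n → n ≤ℝ x → m ≤ℝ x
≤ℝ-downward x m≤n n≤x x<m with ℕ.m≤n⇒m<n∨m≡n m≤n
... | inj₂ refl = n≤x x<m
-- By roundedness the upper cut is upward closed: if `x` were below `m`, it would be below `n`.
... | inj₁ m<n  = n≤x (Equivalence.from (ℝ.upper-rounded x _) (_ , ι-mono-< (ℤ.+<+ m<n) , x<m))

-- The maximum is itself listed, hence at most `x`, and so is everything below it. Up to the
-- maximum, the condition involving `x` therefore holds automatically, and membership depends on
-- prime factors alone.
enumeration⇒smooth : ∀ {P : Pred ℕ ℓ} {x} → ns Enumerates (⟨ P ⟩≤ x) → max 0 ns ∈ ns → SmoothUpTo (max 0 ns) ns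
enumeration⇒smooth {ns = ns} {P} {x} e N∈ns = record
  { unique  = unique
  ; nonZero = proj₁ ∘ proj₁ ∘ to
  ; bounded = bounded
  ; sound   = λ n∈ns pp p∣n →
      let instance _ = proj₁ (proj₁ (to n∈ns)) in
      from {{prime⇒nonZero pp}} (ℕ.≤-trans (∣⇒≤ p∣n) (bounded n∈ns)) λ q pq q∣p →
        proj₂ (proj₁ (to n∈ns)) q pq (∣-trans q∣p p∣n)
  -- A listed prime satisfies `P` because it divides itself.
  ; closed  = λ n≤N ps∈ns → from n≤N λ p pp p∣n →
      proj₂ (proj₁ (to (ps∈ns pp p∣n))) p pp ∣-refl
  }
  where
  open _Enumerates_ e
  to : n ∈ ns → ⟨ P ⟩ n × n ≤ℝ x
  to {n} = Equivalence.to (complete n)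
  bounded : n ∈ ns → n ℕ.≤ max 0 ns
  bounded = All.lookup (xs≤max 0 ns)
  from : .{{NonZero n}} → n ℕ.≤ max 0 ns → (∀ p → Prime p → p ∣ n → P p) → n ∈ ns
  -- The instance is irrelevant, so the `NonZero n` inside the pair is rebuilt from positivity.
  from {n} n≤N ps = Equivalence.from (complete n) ((ℕ.>-nonZero (ℕ.>-nonZero⁻¹ n) , ps) , ≤ℝ-downward x n≤N (proj₂ (to N∈ns)))

theorem1p1 : ∀ {ℓ} (P : Pred ℕ ℓ) → P ⊆ Prime → (x : ℝ) (ns : List ℕ) →
    ns Enumerates (⟨ P ⟩≤ x) → ∣ ∑ ns μ[n]/n ∣ ≤ 1ℚ
-- This is the case of `x` below one: even 1 is not listed, and the sum is 0.
theorem1p1 P _ x []         e = 0≤1ℚ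
theorem1p1 P _ x ns@(n ∷ _) e = ∣∑∣≤1 (enumeration⇒smooth {x = x} e N∈ns) {{nonZero N∈ns}}
  where
  nonZero : ∀ {m} → m ∈ ns → NonZero m
  nonZero {m} m∈ns = proj₁ (proj₁ (Equivalence.to (_Enumerates_.complete e m) m∈ns))
  -- `argmax-sel` leaves open that the maximum is the default 0 instead of an entry; the positive
  -- entry `n` excludes this.
  0<N : 0 ℕ.< max 0 ns
  0<N = ℕ.<-≤-trans (ℕ.>-nonZero⁻¹ n {{nonZero (here refl)}}) (All.head (xs≤max 0 ns))
  N∈ns : max 0 ns ∈ ns
  N∈ns = [ (λ N≡0 → contradiction (sym N≡0) (ℕ.<⇒≢ 0<N)) , id ]′ (argmax-sel id 0 ns)
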